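{- Let $G$ and $H$ be two nontrivial graphs such that $G$ is connected and the lexicographic product $G\circ H$ is not complete. Then $tpc(G\circ H)=3$.
   Context: All graphs are simple, finite and undirected; nontrivial means having at least two vertices. The lexicographic product $G\circ H$ has vertex set $V(G)\times V(H)$, with $(g,h)$ adjacent to $(g',h')$ iff $gg'\in E(G)$, or $g=g'$ and $hh'\in E(H)$. A graph is total-colored if all its vertices and edges are assigned colors. A path in a total-colored graph is a total proper path if (i) any two adjacent edges on the path differ in color, (ii) any two adjacent internal vertices of the path differ in color, and (iii) every internal vertex of the path differs in color from the edges of the path incident with it. A total-colored graph is total-proper connected if any two vertices are joined by a total proper path. For a connected graph $G$, $tpc(G)$ is the smallest number of colors in a total-coloring making $G$ total-proper connected. -}

module Defs where

open import Data.Nat using (ℕ; _≤_)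
open import Data.Fin using (Fin)
open import Data.Bool using (Bool; true; false; _∨_; _∧_)
open import Data.Product using (Σ; ∃; _×_; _,_)
open import Data.List using (List; []; _∷_; _++_)
open import Data.List.Relation.Unary.Unique.Propositional using (Unique)
open import Data.Unit using (⊤)
open import Relation.Binary.PropositionalEquality using (_≡_; _≢_)
open import Relation.Nullary using (¬_)
open import Relation.Nullary.Decidable using (⌊_⌋)
open import Relation.Binary using (DecidableEquality)

record Graph (V : Set) : Set where
  field
    adj    : V → V → Bool
    adj-sym    : ∀ u v → adj u v ≡ adj v u
    adj-irrefl : ∀ v → adj v v ≡ false
open Graph public

lexAdj : ∀ {n m} → Graph (Fin n) → Graph (Fin m) →
         Fin n × Fin m → Fin n × Fin m → Bool
lexAdj G H (g , h) (g' , h') = adj G g g' ∨ (⌊ g Data.Fin.≟ g' ⌋ ∧ adj H h h')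

private
  open import Relation.Nullary using (yes; no)
  open import Relation.Binary.PropositionalEquality using (refl; cong₂; sym; trans)
  open import Data.Bool.Properties using (∧-zeroʳ)
  import Data.Empty as E

  dsym : ∀ {n} (g g' : Fin n) → ⌊ g Data.Fin.≟ g' ⌋ ≡ ⌊ g' Data.Fin.≟ g ⌋
  dsym g g' with g Data.Fin.≟ g' | g' Data.Fin.≟ g
  ... | yes _ | yes _ = refl
  ... | no _  | no _  = refl
  ... | yes p | no q  = E.⊥-elim (q (sym p))
  ... | no p  | yes q = E.⊥-elim (p (sym q))

  lexSym : ∀ {n m} (G : Graph (Fin n)) (H : Graph (Fin m)) u v →
           lexAdj G H u v ≡ lexAdj G H v u
  lexSym G H (g , h) (g' , h') =
    cong₂ _∨_ (adj-sym G g g') (cong₂ _∧_ (dsym g g') (adj-sym H h h'))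

  lexIrr : ∀ {n m} (G : Graph (Fin n)) (H : Graph (Fin m)) v →
           lexAdj G H v v ≡ false
  lexIrr G H (g , h) rewrite adj-irrefl G g | adj-irrefl H h =
    ∧-zeroʳ ⌊ g Data.Fin.≟ g ⌋

lex : ∀ {n m} → Graph (Fin n) → Graph (Fin m) → Graph (Fin n × Fin m)
lex G H = record
  { adj        = lexAdj G H
  ; adj-sym    = lexSym G H
  ; adj-irrefl = lexIrr G H
  }

module _ {V : Set} (G : Graph V) where

  Consecutive : List V → Set
  Consecutive (a ∷ b ∷ rest) = (adj G a b ≡ true) × Consecutive (b ∷ rest)
  Consecutive _ = ⊤

  IsPath : List V → Set
  IsPath ps = Consecutive ps × Unique ps

  Connected : Set
  Connected = ∀ u v → u ≢ v → ∃ λ (mid : List V) → Consecutive (u ∷ mid ++ v ∷ [])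

  Complete : Set
  Complete = ∀ u v → u ≢ v → adj G u v ≡ true

-- A total colouring with k colours: a colour for every vertex and a colour for
-- every (unordered) pair, symmetric; only the values on edges matter.
record TotalColouring (V : Set) (k : ℕ) : Set where
  field
    vcol : V → Fin k
    ecol : V → V → Fin k
    ecol-sym : ∀ u v → ecol u v ≡ ecol v u
open TotalColouring public

module _ {V : Set} {k : ℕ} (c : TotalColouring V k) where

  -- condition (ii): if the vertex following internal vertex b is itself internal,
  -- their colours differ
  NextInternalOK : V → List V → Set
  NextInternalOK b (x ∷ _ ∷ _) = vcol c b ≢ vcol c x
  NextInternalOK b _ = ⊤

  -- total proper conditions on a vertex sequence (every window a,b,c has b internal)
  TotalProper : List V → Set
  TotalProper (a ∷ b ∷ d ∷ rest) =
      (ecol c a b ≢ ecol c b d)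
    × (vcol c b ≢ ecol c a b)
    × (vcol c b ≢ ecol c b d)
    × NextInternalOK b (d ∷ rest)
    × TotalProper (b ∷ d ∷ rest)
  TotalProper _ = ⊤

module _ {V : Set} (G : Graph V) where

  TotalProperConnected : ∀ {k} → TotalColouring V k → Set
  TotalProperConnected c =
    ∀ u v → u ≢ v → ∃ λ (mid : List V) →
      IsPath G (u ∷ mid ++ v ∷ []) × TotalProper c (u ∷ mid ++ v ∷ [])

  HasTPC : ℕ → Set
  HasTPC k = ∃ λ (c : TotalColouring V k) → TotalProperConnected c

  TPC≡ : ℕ → Set
  TPC≡ t = HasTPC t × (∀ k → HasTPC k → t ≤ k)

{-# OPTIONS --safe #-}

-- Three pairwise distinct colours already occur around an internal vertex, so
-- only the upper bound needs a construction.  With colours in ℤ/3, a walk is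
-- total-proper as soon as it passes every internal vertex w of colour x by
-- entering along colour x + 1 and leaving along colour x + 2; this is a local
-- condition on the two ends of each edge, so loops may be erased, and it is
-- symmetric under reversal.  Fix an edge qr of G and the two forests hanging
-- from q and from r.  Copy 0 of each fibre is used to climb towards the edge
-- and copy 1 to descend from it; the turn is made on the path
--   (q,0) → (r,0) → (q,1) → (r,1)   with colours 0, 1, 2, 0.
-- Every vertex off this path can both be reached from (r,0) and reach (r,0).

module Submission where

open import Defs
open import Data.Bool using (true)
import Data.Bool.Properties as Bool
open import Data.Empty using (⊥-elim)
open import Data.Fin using (Fin; zero; suc)
import Data.Fin.Properties as Fin
open import Data.List using (List; []; _∷_; _++_)
open import Data.List.Membership.Propositional using (_∈_)
import Data.List.Membership.DecPropositional as DecMembership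
open import Data.List.Relation.Unary.All using ([]; _∷_)
import Data.List.Relation.Unary.All.Properties as All
open import Data.List.Relation.Unary.Any using (here; there)
open import Data.List.Relation.Unary.AllPairs using ([]; _∷_)
open import Data.List.Relation.Unary.Unique.Propositional using (Unique)
open import Data.Nat using (ℕ; zero; suc; _+_; _≤_; _<_; z≤n; s≤s; _≤?_)
open import Data.Nat.Properties using (<-cmp; m≤n+m)
open import Data.Product using (∃; _×_; _,_; proj₁; proj₂; swap; -,_)
open import Data.Product.Properties using (≡-dec)
open import Data.Unit using (tt)
open import Function using (_∘_)
open import Relation.Binary using (DecidableEquality; tri<; tri≈; tri>)
open import Relation.Binary.Construct.Closure.ReflexiveTransitive
  using (Star; ε; _◅_; _◅◅_; reverse)
open import Relation.Binary.PropositionalEquality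
  using (_≡_; _≢_; refl; sym; trans; cong; subst; ≢-sym)
open import Relation.Nullary using (¬_; Dec; yes; no; contradiction)
open import Relation.Nullary.Decidable using (_×-dec_)
open import Relation.Unary using (Pred; Decidable)

-- Lower bound

distinct⇒3≤ : ∀ {k} {a b d : Fin k} → a ≢ b → b ≢ d → a ≢ d → 3 ≤ k
distinct⇒3≤ {suc zero} {zero} {zero} a≢b _ _ = contradiction refl a≢b
distinct⇒3≤ {suc (suc zero)} {zero} {zero} a≢b _ _ = contradiction refl a≢b
distinct⇒3≤ {suc (suc zero)} {zero} {suc zero} {zero} _ _ a≢d = contradiction refl a≢d
distinct⇒3≤ {suc (suc zero)} {zero} {suc zero} {suc zero} _ b≢d _ = contradiction refl b≢d
distinct⇒3≤ {suc (suc zero)} {suc zero} {suc zero} a≢b _ _ = contradiction refl a≢b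
distinct⇒3≤ {suc (suc zero)} {suc zero} {zero} {zero} _ b≢d _ = contradiction refl b≢d
distinct⇒3≤ {suc (suc zero)} {suc zero} {zero} {suc zero} _ _ a≢d = contradiction refl a≢d
distinct⇒3≤ {suc (suc (suc k))} _ _ _ = s≤s (s≤s (s≤s z≤n))

internal⇒3≤ : ∀ {V : Set} {k} (c : TotalColouring V k) u a ms v →
              TotalProper c (u ∷ a ∷ ms ++ v ∷ []) → 3 ≤ k
internal⇒3≤ c u a []      v (e≢e′ , x≢e , x≢e′ , _) = distinct⇒3≤ x≢e e≢e′ x≢e′
internal⇒3≤ c u a (_ ∷ _) v (e≢e′ , x≢e , x≢e′ , _) = distinct⇒3≤ x≢e e≢e′ x≢e′

-- With fewer than three colours a total proper path has no internal vertex, so every joining path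
-- is a single edge and the graph is complete.
incomplete⇒3≤ : ∀ {V : Set} (Γ : Graph V) → ¬ Complete Γ →
                ∀ k → HasTPC Γ k → 3 ≤ k
incomplete⇒3≤ Γ incomplete k (c , connected) with 3 ≤? k
... | yes 3≤k = 3≤k
... | no  3≰k = ⊥-elim (incomplete λ u v u≢v → direct u v (connected u v u≢v))
  where
  direct : ∀ u v → (∃ λ mid → IsPath Γ (u ∷ mid ++ v ∷ []) ×
                              TotalProper c (u ∷ mid ++ v ∷ [])) →
           adj Γ u v ≡ true
  direct u v ([]     , ((uv , _) , _) , _)      = uv
  direct u v (a ∷ ms , _              , proper) =
    contradiction (internal⇒3≤ c u a ms v proper) 3≰k

-- Loop erasure

-- Entry w u and Exit w u both concern passing through w along the edge wu; they
-- are exchanged when a walk is reversed.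
module Erasure
  {V : Set} (_≟_ : DecidableEquality V) (Γ : Graph V) {k} (c : TotalColouring V k)
  (Entry Exit : V → V → Set)
  (entry-adj : ∀ {w u} → Entry w u → adj Γ w u ≡ true)
  (exit-adj  : ∀ {w u} → Exit w u → adj Γ w u ≡ true)
  (pass : ∀ {w u v} → Entry w u → Exit w v →
          ecol c w u ≢ ecol c w v × vcol c w ≢ ecol c w u × vcol c w ≢ ecol c w v)
  (advance : ∀ {w w′} → Exit w w′ → Entry w′ w → vcol c w ≢ vcol c w′)
  where

  open DecMembership _≟_ using (_∈?_)

  Arc : V → V → Set
  Arc w w′ = Exit w w′ × Entry w′ w

  TotalProperPath : V → V → Set
  TotalProperPath u v = ∃ λ mid → IsPath Γ (u ∷ mid ++ v ∷ []) ×
                                  TotalProper c (u ∷ mid ++ v ∷ [])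

  -- The closing step asks for no `Entry`: `v` is an end of the path and is not passed.
  Run : V → List V → V → Set
  Run w []       v = Exit w v
  Run w (x ∷ ms) v = Arc w x × Run x ms v

  SimpleRun : V → V → Set
  SimpleRun w v = ∃ λ ms → Run w ms v × Unique (w ∷ ms ++ v ∷ [])

  suffix : ∀ {u v} w ms → Run w ms v → Unique (w ∷ ms ++ v ∷ []) →
           u ∈ w ∷ ms → SimpleRun u v
  suffix w ms       run       uniq       (here refl) = ms , run , uniq
  suffix w (x ∷ ms) (_ , run) (_ ∷ uniq) (there u∈)  = suffix x ms run uniq u∈

  -- If `u` recurs, the run restarts at the recurrence. `Exit` there does not depend on how `u` was
  -- entered, so it still fits whatever precedes `u`.
  prepend : ∀ {u v} w → Arc u w → u ≢ v → SimpleRun w v → SimpleRun u v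
  prepend {u} w arc u≢v (ms , run , uniq) with u ∈? (w ∷ ms)
  ... | yes u∈ = suffix w ms run uniq u∈
  ... | no  u∉ = w ∷ ms , (arc , run) , All.++⁺ (All.¬Any⇒All¬ _ u∉) (u≢v ∷ []) ∷ uniq

  erase : ∀ {w w′ v} → Star Arc w w′ → Exit w′ v → w ≢ v → SimpleRun w v
  erase ε exit w≢v = [] , exit , (w≢v ∷ []) ∷ [] ∷ []
  erase {v = v} (_◅_ {j = x} arc arcs) exit w≢v with x ≟ v
  -- The walk meets `v` early and is cut there; the exit half of the arc suffices.
  ... | yes refl = [] , proj₁ arc , (w≢v ∷ []) ∷ [] ∷ []
  ... | no  x≢v  = prepend x arc w≢v (erase arcs exit x≢v)

  run-consecutive : ∀ {v} w ms → Run w ms v → Consecutive Γ (w ∷ ms ++ v ∷ [])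
  run-consecutive w []       exit               = exit-adj exit , tt
  run-consecutive w (x ∷ ms) ((exit , _) , run) = exit-adj exit , run-consecutive x ms run

  run-proper : ∀ {u v} w ms → Entry w u → Run w ms v →
               TotalProper c (u ∷ w ∷ ms ++ v ∷ [])
  run-proper {u} w [] entry exit
    with e≢e′ , x≢e , x≢e′ ← pass entry exit
    rewrite ecol-sym c u w = e≢e′ , x≢e , x≢e′ , tt , tt
  run-proper {u} {v} w (d ∷ ms) entry ((exit , entry′) , run)
    with rest ← run-proper d ms entry′ run
    with e≢e′ , x≢e , x≢e′ ← pass entry exit
    rewrite ecol-sym c u w = e≢e′ , x≢e , x≢e′ , next ms , rest
    where
    next : ∀ ms → NextInternalOK c w (d ∷ ms ++ v ∷ [])
    next []      = advance exit entry′
    next (_ ∷ _) = advance exit entry′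

  edge-path : ∀ {u v} → u ≢ v → adj Γ u v ≡ true → TotalProperPath u v
  edge-path u≢v uv = [] , ((uv , tt) , (u≢v ∷ []) ∷ [] ∷ []) , tt

  walk-path : ∀ {u w w′ v} → u ≢ v → Entry w u → Star Arc w w′ → Exit w′ v →
              TotalProperPath u v
  walk-path {u} {w} {_} {v} u≢v entry arcs exit with w ≟ v
  ... | yes refl = edge-path u≢v (trans (adj-sym Γ u v) (entry-adj entry))
  ... | no  w≢v  with ms , run , uniq ← erase arcs exit w≢v | u ∈? (w ∷ ms)
  ...   | no u∉ = w ∷ ms
                , ( (trans (adj-sym Γ u w) (entry-adj entry) , run-consecutive w ms run)
                  , All.++⁺ (All.¬Any⇒All¬ _ u∉) (u≢v ∷ []) ∷ uniq)
                , run-proper w ms entry run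
  -- The walk returns to its start: only the part after the return is kept, and its first arc
  -- supplies the `Entry` needed by `run-proper`.
  ...   | yes u∈ with suffix w ms run uniq u∈
  ...     | []      , exit′ , _ = edge-path u≢v (exit-adj exit′)
  ...     | x ∷ ms′ , run′@((_ , entry′) , run″) , uniq′ =
    x ∷ ms′ , (run-consecutive u (x ∷ ms′) run′ , uniq′) , run-proper x ms′ entry′ run″

-- Ranks

least : ∀ {p} {P : Pred ℕ p} → Decidable P → ∀ k → P k →
        ∃ λ j → P j × (∀ i → i < j → ¬ P i)
least P? zero    pk = zero , pk , λ _ ()
least P? (suc k) pk with P? zero
... | yes p0 = zero , p0 , λ _ ()
... | no ¬p0 with j , pj , below ← least (P? ∘ suc) k pk =
  suc j , pj , λ { zero _ → ¬p0 ; (suc i) (s≤s i<j) → below i i<j }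

-- Even ranks belong to the forest hanging from q, odd ranks to that hanging from r.
record Ranking {n} (G : Graph (Fin n)) : Set where
  field
    q r    : Fin n
    qr     : adj G q r ≡ true
    rk     : Fin n → ℕ
    rk-q   : rk q ≡ 0
    rk-r   : rk r ≡ 1
    rk≡0   : ∀ g → rk g ≡ 0 → g ≡ q
    rk≡1   : ∀ g → rk g ≡ 1 → g ≡ r
    parent : ∀ g k → rk g ≡ 2 + k → ∃ λ p → adj G g p ≡ true × rk p ≡ k

module _ {n} (G : Graph (Fin n)) (connected : Connected G)
         (q r : Fin n) (qr : adj G q r ≡ true) where

  private
    -- Index `2d` stands for a walk of length `d` to `q`, index `2d + 1` for one to `r`. The least
    -- index is thus the smaller of `2 dist(q,g)` and `2 dist(r,g) + 1`, with no ties between the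
    -- two forests.
    Reach : ℕ → Fin n → Set
    Reach zero          g = g ≡ q
    Reach (suc zero)    g = g ≡ r
    Reach (suc (suc k)) g = ∃ λ p → adj G g p ≡ true × Reach k p

    reach? : ∀ g k → Dec (Reach k g)
    reach? g zero          = g Fin.≟ q
    reach? g (suc zero)    = g Fin.≟ r
    reach? g (suc (suc k)) = Fin.any? λ p → (adj G g p Bool.≟ true) ×-dec reach? p k

    reach-walk : ∀ {k v} u mid → Reach k u → Consecutive G (u ∷ mid ++ v ∷ []) →
                 ∃ λ k′ → Reach k′ v
    reach-walk {k} {v} u []      p (uv , _)  = 2 + k , u , trans (adj-sym G v u) uv , p
    reach-walk {k}     u (x ∷ _) p (ux , cs) =
      reach-walk {2 + k} x _ (u , trans (adj-sym G x u) ux , p) cs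

    reached : ∀ g → ∃ λ k → Reach k g
    reached g with q Fin.≟ g
    ... | yes q≡g = 0 , sym q≡g
    ... | no  q≢g with mid , cs ← connected q g q≢g = reach-walk {0} q mid refl cs

    minimal : ∀ g → ∃ λ k → Reach k g × (∀ i → i < k → ¬ Reach i g)
    minimal g = least (reach? g) _ (proj₂ (reached g))

    rk : Fin n → ℕ
    rk = proj₁ ∘ minimal

    rk-reach : ∀ g → Reach (rk g) g
    rk-reach = proj₁ ∘ proj₂ ∘ minimal

    rk-unique : ∀ {k} g → Reach k g → (∀ i → i < k → ¬ Reach i g) → rk g ≡ k
    rk-unique {k} g reach below with <-cmp (rk g) k
    ... | tri< rk<k _ _ = contradiction (rk-reach g) (below _ rk<k)
    ... | tri≈ _ rk≡k _ = rk≡k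
    ... | tri> _ _ k<rk = contradiction reach (proj₂ (proj₂ (minimal g)) k k<rk)

    r≢q : r ≢ q
    r≢q refl with () ← trans (sym (adj-irrefl G q)) qr

    -- If `p` were reached at some `i < k`, then `g` would be reached at `2 + i`, below its minimum.
    rk-parent : ∀ g k → rk g ≡ 2 + k → ∃ λ p → adj G g p ≡ true × rk p ≡ k
    rk-parent g k eq with minimal g
    rk-parent g k refl | _ , (p , gp , reach) , below =
      p , gp , rk-unique p reach λ i i<k reach′ → below (2 + i) (s≤s (s≤s i<k)) (p , gp , reach′)

  ranking : Ranking G
  ranking = record
    { q = q ; r = r ; qr = qr ; rk = rk
    ; rk-q   = rk-unique q refl λ _ ()
    ; rk-r   = rk-unique r refl λ { zero _ → r≢q ; (suc _) (s≤s ()) }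
    ; rk≡0   = λ g eq → subst (λ k → Reach k g) eq (rk-reach g)
    ; rk≡1   = λ g eq → subst (λ k → Reach k g) eq (rk-reach g)
    ; parent = rk-parent
    }

first-edge : ∀ {V : Set} (Γ : Graph V) → Connected Γ → ∀ {u v} → u ≢ v →
             ∃ λ w → adj Γ u w ≡ true
first-edge Γ connected {u} {v} u≢v with connected u v u≢v
... | []    , uv , _ = v , uv
... | x ∷ _ , ux , _ = x , ux

connected⇒ranking : ∀ {n} (G : Graph (Fin n)) → 2 ≤ n → Connected G → Ranking G
connected⇒ranking G (s≤s (s≤s z≤n)) connected
  with r , qr ← first-edge G connected {zero} {suc zero} (λ ()) =
  ranking G connected zero r qr

-- The colouring

next : Fin 3 → Fin 3
next zero             = suc zero
next (suc zero)       = suc (suc zero)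
next (suc (suc zero)) = zero

next≢ : ∀ x → x ≢ next x
next≢ zero             ()
next≢ (suc zero)       ()
next≢ (suc (suc zero)) ()

next³ : ∀ x → next (next (next x)) ≡ x
next³ zero             = refl
next³ (suc zero)       = refl
next³ (suc (suc zero)) = refl

next²≢ : ∀ x → x ≢ next (next x)
next²≢ x eq = next≢ (next (next x)) (trans (sym eq) (sym (next³ x)))

next-injective : ∀ {x y} → next x ≡ next y → x ≡ y
next-injective {x} {y} eq =
  trans (sym (next³ x)) (trans (cong (next ∘ next) eq) (next³ y))

-- Vertex colours grow by 1 along each arc. Climbing lowers the rank by 2, so `upColour` drops by 1
-- every two ranks, while `downColour` rises by 1. The base values are the vertex colours 0, 1, 2, 0
-- of the turning path.
upColour : ℕ → Fin 3
upColour zero          = zero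
upColour (suc zero)    = suc zero
upColour (suc (suc k)) = next (next (upColour k))

downColour : ℕ → Fin 3
downColour zero          = suc (suc zero)
downColour (suc zero)    = zero
downColour (suc (suc k)) = next (downColour k)

module LexColouring {n m} (G : Graph (Fin n)) (H : Graph (Fin (2 + m))) (R : Ranking G) where

  open Ranking R

  V : Set
  V = Fin n × Fin (2 + m)

  Γ : Graph V
  Γ = lex G H

  shadeVertex : ℕ → Fin (2 + m) → Fin 3
  shadeVertex i zero    = upColour i
  shadeVertex i (suc _) = downColour i

  -- The colour of the edge between copy h of q and copy h′ of r.
  rootShade : Fin (2 + m) → Fin (2 + m) → Fin 3
  rootShade zero          zero    = suc (suc zero)
  rootShade (suc zero)    zero    = zero
  rootShade (suc (suc _)) zero    = suc (suc zero)
  rootShade zero          (suc _) = suc zero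
  rootShade (suc zero)    (suc _) = suc zero
  rootShade (suc (suc _)) (suc _) = suc (suc zero)

  -- Away from qr the parent's copy alone decides: copy 0 is entered from every
  -- child, and copy 1 is left towards every child.
  parentShade : ℕ → Fin (2 + m) → Fin 3
  parentShade i zero    = next (upColour i)
  parentShade i (suc _) = next (next (downColour i))

  ascending : ℕ → Fin (2 + m) → ℕ → Fin (2 + m) → Fin 3
  -- The first rank is the smaller one, hence 0 here; ranks 0 and 1 occur only at `q` and `r`, so
  -- this case is exactly the edge `qr`.
  ascending i h (suc zero) h′ = rootShade h h′
  ascending i h _          h′ = parentShade i h

  shade : ℕ → Fin (2 + m) → ℕ → Fin (2 + m) → Fin 3
  shade i h j h′ with <-cmp i j
  ... | tri< _ _ _ = ascending i h j h′
  -- A default, constant so as to be symmetric in the copies; the walks built below change rank at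
  -- every step.
  ... | tri≈ _ _ _ = zero
  ... | tri> _ _ _ = ascending j h′ i h

  shade-< : ∀ {i j} h h′ → i < j → shade i h j h′ ≡ ascending i h j h′
  shade-< {i} {j} h h′ i<j with <-cmp i j
  ... | tri< _ _ _  = refl
  ... | tri≈ ≮ _ _  = contradiction i<j ≮
  ... | tri> ≮ _ _  = contradiction i<j ≮

  shade-> : ∀ {i j} h h′ → j < i → shade i h j h′ ≡ ascending j h′ i h
  shade-> {i} {j} h h′ j<i with <-cmp i j
  ... | tri< _ _ ≯ = contradiction j<i ≯
  ... | tri≈ _ _ ≯ = contradiction j<i ≯
  ... | tri> _ _ _ = refl

  shade-≡ : ∀ i h h′ → shade i h i h′ ≡ zero
  shade-≡ i h h′ with <-cmp i i
  ... | tri< _ ≢ _ = contradiction refl ≢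
  ... | tri≈ _ _ _ = refl
  ... | tri> _ ≢ _ = contradiction refl ≢

  shade-sym : ∀ i h j h′ → shade i h j h′ ≡ shade j h′ i h
  shade-sym i h j h′ with <-cmp i j
  ... | tri< i<j _ _  = sym (shade-> h′ h i<j)
  ... | tri≈ _ refl _ = sym (shade-≡ i h′ h)
  ... | tri> _ _ j<i  = sym (shade-< h′ h j<i)

  colouring : TotalColouring V 3
  colouring = record
    { vcol     = λ (g , h) → shadeVertex (rk g) h
    ; ecol     = λ (g , h) (g′ , h′) → shade (rk g) h (rk g′) h′
    ; ecol-sym = λ (g , h) (g′ , h′) → shade-sym (rk g) h (rk g′) h′
    }

  -- Passing conditions and two-way linking

  Entry Exit : V → V → Set
  Entry w u = adj Γ w u ≡ true × ecol colouring w u ≡ next (vcol colouring w)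
  Exit  w v = adj Γ w v ≡ true × ecol colouring w v ≡ next (next (vcol colouring w))

  pass : ∀ {w u v} → Entry w u → Exit w v →
         ecol colouring w u ≢ ecol colouring w v ×
         vcol colouring w ≢ ecol colouring w u ×
         vcol colouring w ≢ ecol colouring w v
  pass {w} (_ , e) (_ , e′) rewrite e | e′ =
    next≢ (next x) , next≢ x , next²≢ x
    where x = vcol colouring w

  -- The common edge has colour `x + 2` seen from `w` and `x′ + 1` seen from `w′`; equal `x` and
  -- `x′` would give `x = x + 1`.
  advance : ∀ {w w′} → Exit w w′ → Entry w′ w → vcol colouring w ≢ vcol colouring w′
  advance {w} {w′} (_ , e) (_ , e′) eq =
    next≢ x (next-injective (trans (cong next eq)
      (trans (sym e′) (trans (ecol-sym colouring w′ w) e))))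
    where x = vcol colouring w

  pass-back : ∀ {w u v} → Exit w u → Entry w v →
              ecol colouring w u ≢ ecol colouring w v ×
              vcol colouring w ≢ ecol colouring w u ×
              vcol colouring w ≢ ecol colouring w v
  pass-back exit entry with e≢e′ , x≢e , x≢e′ ← pass entry exit =
    ≢-sym e≢e′ , x≢e′ , x≢e

  retreat : ∀ {w w′} → Entry w w′ → Exit w′ w → vcol colouring w ≢ vcol colouring w′
  retreat entry exit = ≢-sym (advance exit entry)

  _≟_ : DecidableEquality V
  _≟_ = ≡-dec Fin._≟_ Fin._≟_

  module Forward = Erasure _≟_ Γ colouring Entry Exit proj₁ proj₁ pass advance
  module Backward = Erasure _≟_ Γ colouring Exit Entry proj₁ proj₁ pass-back retreat

  open Forward using (Arc; TotalProperPath; edge-path)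

  Linked : V → V → Set
  Linked u v = u ≢ v → TotalProperPath u v × TotalProperPath v u

  linked-sym : ∀ {u v} → Linked u v → Linked v u
  linked-sym l v≢u = swap (l (≢-sym v≢u))

  adjacent : ∀ {u v} → adj Γ u v ≡ true → Linked u v
  adjacent {u} {v} uv u≢v =
    edge-path u≢v uv , edge-path (≢-sym u≢v) (trans (adj-sym Γ v u) uv)

  -- One walk serves both directions: read backwards, its arcs are arcs of `Backward`.
  through : ∀ {u w w′ v} → Entry w u → Star Arc w w′ → Exit w′ v → Linked u v
  through entry arcs exit u≢v =
    Forward.walk-path u≢v entry arcs exit ,
    Backward.walk-path (≢-sym u≢v) exit (reverse swap arcs) entry

  -- Arcs at the root edge and in the forests

  up down : Fin n → V
  up   g = g , zero
  down g = g , suc zero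

  lex-adj : ∀ {g g′} h h′ → adj G g g′ ≡ true → adj Γ (g , h) (g′ , h′) ≡ true
  lex-adj h h′ gg′ rewrite gg′ = refl

  qr-adj : ∀ h h′ → adj Γ (q , h) (r , h′) ≡ true
  qr-adj h h′ = lex-adj h h′ qr

  rq-adj : ∀ h h′ → adj Γ (r , h) (q , h′) ≡ true
  rq-adj h h′ = lex-adj h h′ (trans (adj-sym G r q) qr)

  qr-shade : ∀ h h′ → ecol colouring (q , h) (r , h′) ≡ rootShade h h′
  qr-shade h h′ rewrite rk-q | rk-r = refl

  rq-shade : ∀ h h′ → ecol colouring (r , h) (q , h′) ≡ rootShade h′ h
  rq-shade h h′ rewrite rk-q | rk-r = refl

  entry-q : ∀ h h′ → rootShade h h′ ≡ next (shadeVertex 0 h) →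
            Entry (q , h) (r , h′)
  entry-q h h′ eq = qr-adj h h′ , trans (qr-shade h h′) (trans eq
    (cong (λ i → next (shadeVertex i h)) (sym rk-q)))

  exit-q : ∀ h h′ → rootShade h h′ ≡ next (next (shadeVertex 0 h)) →
           Exit (q , h) (r , h′)
  exit-q h h′ eq = qr-adj h h′ , trans (qr-shade h h′) (trans eq
    (cong (λ i → next (next (shadeVertex i h))) (sym rk-q)))

  entry-r : ∀ h h′ → rootShade h′ h ≡ next (shadeVertex 1 h) →
            Entry (r , h) (q , h′)
  entry-r h h′ eq = rq-adj h h′ , trans (rq-shade h h′) (trans eq
    (cong (λ i → next (shadeVertex i h)) (sym rk-r)))

  exit-r : ∀ h h′ → rootShade h′ h ≡ next (next (shadeVertex 1 h)) →
           Exit (r , h) (q , h′)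
  exit-r h h′ eq = rq-adj h h′ , trans (rq-shade h h′) (trans eq
    (cong (λ i → next (next (shadeVertex i h))) (sym rk-r)))

  arc₁ : Arc (up q) (up r)
  arc₁ = exit-q _ _ refl , entry-r _ _ refl

  arc₂ : Arc (up r) (down q)
  arc₂ = exit-r _ _ refl , entry-q _ _ refl

  arc₃ : Arc (down q) (down r)
  arc₃ = exit-q _ _ refl , entry-r _ _ refl

  module _ {g p k} (gp : adj G g p ≡ true) (rk-g : rk g ≡ 2 + k) (rk-p : rk p ≡ k) where

    private
      k<2+k : k < 2 + k
      k<2+k = s≤s (m≤n+m k 1)

    parent-shade : ∀ h h′ → ecol colouring (p , h) (g , h′) ≡ parentShade k h
    parent-shade h h′ rewrite rk-g | rk-p = shade-< h h′ k<2+k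

    child-shade : ∀ h h′ → ecol colouring (g , h′) (p , h) ≡ parentShade k h
    child-shade h h′ = trans (ecol-sym colouring (g , h′) (p , h)) (parent-shade h h′)

    private
      pg : adj G p g ≡ true
      pg = trans (adj-sym G p g) gp

    entry-up : ∀ h → Entry (up p) (g , h)
    entry-up h = lex-adj zero h pg ,
      trans (parent-shade zero h) (cong (next ∘ upColour) (sym rk-p))

    exit-down : ∀ h → Exit (down p) (g , h)
    exit-down h = lex-adj (suc zero) h pg ,
      trans (parent-shade (suc zero) h) (cong (next ∘ next ∘ downColour) (sym rk-p))

    arc-up : Arc (up g) (up p)
    arc-up = (lex-adj zero zero gp ,
              trans (child-shade zero zero)
                -- Two `next` on `upColour (2 + k)` are four on `upColour k`, of which `next³`
                -- cancels three.
                (trans (sym (next³ _)) (cong (next ∘ next ∘ upColour) (sym rk-g))))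
           , entry-up zero

    arc-down : Arc (down p) (down g)
    arc-down = exit-down (suc zero)
             , lex-adj (suc zero) (suc zero) gp
             , trans (child-shade (suc zero) (suc zero)) (cong (next ∘ downColour) (sym rk-g))

  -- Walks through `up r` and the linking of all pairs

  climb : ∀ k g → rk g ≡ k → Star Arc (up g) (up r)
  -- Parents preserve the parity of the rank, so a climb ends at `q` or `r`; from `q` one more arc
  -- leads to `up r`.
  climb zero          g eq rewrite rk≡0 g eq = arc₁ ◅ ε
  climb (suc zero)    g eq rewrite rk≡1 g eq = ε
  climb (suc (suc k)) g eq with p , gp , rk-p ← parent g k eq =
    arc-up gp eq rk-p ◅ climb k p rk-p

  descend : ∀ k g → rk g ≡ k → Star Arc (up r) (down g)
  descend zero          g eq rewrite rk≡0 g eq = arc₂ ◅ ε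
  descend (suc zero)    g eq rewrite rk≡1 g eq = arc₂ ◅ arc₃ ◅ ε
  descend (suc (suc k)) g eq with p , gp , rk-p ← parent g k eq =
    descend k p rk-p ◅◅ arc-down gp eq rk-p ◅ ε

  ToRoot FromRoot : V → Set
  ToRoot   u = ∃ λ w → Entry w u × Star Arc w (up r)
  FromRoot v = ∃ λ w → Star Arc (up r) w × Exit w v

  via-root : ∀ {u v} → ToRoot u → FromRoot v → Linked u v
  via-root (_ , entry , arcs) (_ , arcs′ , exit) = through entry (arcs ◅◅ arcs′) exit

  -- Here `up r` is an end rather than internal, so of the first arc only the `Entry` half is kept.
  root-linked : ∀ {v} → FromRoot v → Linked (up r) v
  root-linked (_ , ε                    , exit) = adjacent (proj₁ exit)
  root-linked (_ , (_ , entry) ◅ arcs , exit) = through entry arcs exit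

  data Position : V → Set where
    both : ∀ {v} → ToRoot v → FromRoot v → Position v
    up-q   : Position (up q)
    up-r   : Position (up r)
    down-q : Position (down q)
    down-r : Position (down r)

  position-rk : ∀ k g → rk g ≡ k → ∀ h → Position (g , h)
  position-rk zero g eq h with rk≡0 g eq
  position-rk zero g eq zero          | refl = up-q
  position-rk zero g eq (suc zero)    | refl = down-q
  position-rk zero g eq (suc (suc h)) | refl =
    -- A further copy of `q` steps straight into `up r` and is reached from `down r` after the whole
    -- turn, both by edges of colour 2.
    both (-, entry-r _ _ refl , ε)
         (-, arc₂ ◅ arc₃ ◅ ε , exit-r _ _ refl)
  position-rk (suc zero) g eq h with rk≡1 g eq
  position-rk (suc zero) g eq zero          | refl = up-r
  position-rk (suc zero) g eq (suc zero)    | refl = down-r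
  position-rk (suc zero) g eq (suc (suc h)) | refl =
    -- A further copy of `r` steps into `up q` at the start of the turn and is reached from
    -- `down q`, both by edges of colour 1.
    both (-, entry-q zero _ refl , arc₁ ◅ ε)
         (-, arc₂ ◅ ε , exit-q (suc zero) _ refl)
  position-rk (suc (suc k)) g eq h with p , gp , rk-p ← parent g k eq =
    both (-, entry-up gp eq rk-p h , climb k p rk-p)
         (-, descend k p rk-p , exit-down gp eq rk-p h)

  position : ∀ v → Position v
  position (g , h) = position-rk (rk g) g refl h

  to-up-q : ToRoot (up q)
  to-up-q = -, proj₂ arc₁ , ε

  from-down-q : FromRoot (down q)
  from-down-q = -, ε , proj₁ arc₂

  from-down-r : FromRoot (down r)
  from-down-r = -, arc₂ ◅ ε , proj₁ arc₃

  -- On the turning path, `up q` precedes `up r` and so pairs with the `FromRoot` half of `both`;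
  -- `down q` and `down r` follow it and pair with the `ToRoot` half. Two of its vertices in the
  -- same fibre are joined along the path itself.
  linked : ∀ {u v} → Position u → Position v → Linked u v
  linked (both to _)   (both _ from) = via-root to from
  linked (both _ from) up-q          = linked-sym (via-root to-up-q from)
  linked (both _ from) up-r          = linked-sym (root-linked from)
  linked (both to _)   down-q        = via-root to from-down-q
  linked (both to _)   down-r        = via-root to from-down-r
  linked up-q          (both _ from) = via-root to-up-q from
  linked up-q          up-q          = contradiction refl
  linked up-q          up-r          = adjacent (qr-adj _ _)
  linked up-q          down-q        = via-root to-up-q from-down-q
  linked up-q          down-r        = adjacent (qr-adj _ _)
  linked up-r          (both _ from) = root-linked from
  linked up-r          up-q          = adjacent (rq-adj _ _)
  linked up-r          up-r          = contradiction refl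
  linked up-r          down-q        = root-linked from-down-q
  linked up-r          down-r        = root-linked from-down-r
  linked down-q        (both to _)   = linked-sym (via-root to from-down-q)
  linked down-q        up-q          = linked-sym (via-root to-up-q from-down-q)
  linked down-q        up-r          = linked-sym (root-linked from-down-q)
  linked down-q        down-q        = contradiction refl
  linked down-q        down-r        = adjacent (qr-adj _ _)
  linked down-r        (both to _)   = linked-sym (via-root to from-down-r)
  linked down-r        up-q          = adjacent (rq-adj _ _)
  linked down-r        up-r          = linked-sym (root-linked from-down-r)
  linked down-r        down-q        = adjacent (rq-adj _ _)
  linked down-r        down-r        = contradiction refl

  total-proper-connected : TotalProperConnected Γ colouring
  total-proper-connected u v u≢v = proj₁ (linked (position u) (position v) u≢v)

theorem5p1 : ∀ {n m} (G : Graph (Fin n)) (H : Graph (Fin m)) →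
    2 ≤ n → 2 ≤ m → Connected G → ¬ Complete (lex G H) →
    TPC≡ (lex G H) 3
theorem5p1 G H 2≤n (s≤s (s≤s z≤n)) connected incomplete =
  (colouring , total-proper-connected) , incomplete⇒3≤ (lex G H) incomplete
  where open LexColouring G H (connected⇒ranking G 2≤n connected)
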